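{- $Q^{\mathrm{un}}_{\mathrm{Grp}}\mathrm{FO} = \mathrm{CFL}$.
   Context: CFL denotes the class of $\epsilon$-free context-free languages. Words over a finite ordered alphabet are viewed as finite structures with universe $\{1,\dots,n\}$, unary letter predicates $P_a$, linear order $<$, equality, constants min, max; FO denotes first-order logic over this signature (without BIT). Unary Lindström quantifier: for a language $L$ over ordered alphabet $(b_1,\dots,b_t)$ and formulas $\phi_1(x),\dots,\phi_{t-1}(x)$, $Q_L x[\phi_1,\dots,\phi_{t-1}]$ holds on $w$ of length $n$ iff the word of length $n$ whose $i$th letter is $b_j$ for the least $j$ with $w\models\phi_j(i)$, and $b_t$ if none, belongs to $L$. A groupoid is a finite set $G$ with an arbitrary binary operation; $\mathcal W(S,G)$, $S\subseteq G$, is the set of nonempty words over alphabet $G$ evaluating into $S$ under some legal bracketing. $Q^{\mathrm{un}}_{\mathrm{Grp}}\mathrm{FO}$ is the class of languages definable by applying a single unary quantifier $Q_L$, $L=\mathcal W(S,G)$ for some finite groupoid $G$ and $S\subseteq G$, to a tuple of FO formulas. -}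

module Defs where

open import Data.Nat using (ℕ; zero; suc)
open import Data.Fin using (Fin; zero; suc; fromℕ)
open import Data.Fin.Properties using (_≟_; _<?_)
open import Data.Fin.Subset using (Subset; _∈_)
open import Data.Bool using (Bool; true; false; not; _∧_; _∨_; if_then_else_)
open import Data.List using (List; []; _∷_; _++_; allFin; tabulate)
open import Data.Bool.ListAction using (any; all)
open import Data.List.Membership.Propositional using () renaming (_∈_ to _∈ₗ_)
open import Data.Sum using (_⊎_; inj₁; inj₂)
open import Data.Product using (Σ; _×_; _,_; ∃)
open import Data.Empty using (⊥)
open import Relation.Nullary using (¬_)
open import Relation.Nullary.Decidable using (⌊_⌋)
open import Relation.Binary.PropositionalEquality using (_≡_)
open import Function.Bundles using (_⇔_)
import Data.Vec.Functional as VF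

Word : ℕ → Set
Word k = List (Fin k)

Language : ℕ → Set₁
Language k = Word k → Set

_≐ₗ_ : ∀ {k} → Language k → Language k → Set
L ≐ₗ L' = ∀ w → L w ⇔ L' w

-- First-order logic over words: letter predicates P_a, <, =, min, max.
-- Formula k m : formulas over alphabet Fin k with free variables Fin m
-- (de Bruijn style: ∃'/∀' bind variable zero).

data Term (m : ℕ) : Set where
  var  : Fin m → Term m
  tmin : Term m
  tmax : Term m

data Formula (k : ℕ) : ℕ → Set where
  P     : ∀ {m} → Fin k → Term m → Formula k m
  _==_  : ∀ {m} → Term m → Term m → Formula k m
  _<'_  : ∀ {m} → Term m → Term m → Formula k m
  ¬'_   : ∀ {m} → Formula k m → Formula k m
  _∧'_  : ∀ {m} → Formula k m → Formula k m → Formula k m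
  _∨'_  : ∀ {m} → Formula k m → Formula k m → Formula k m
  ∃'    : ∀ {m} → Formula k (suc m) → Formula k m
  ∀'    : ∀ {m} → Formula k (suc m) → Formula k m

-- A nonempty word of length suc n as a structure: positions Fin (suc n),
-- position zero is min, position fromℕ n is max.
termVal : ∀ {m n} → Term m → (Fin m → Fin (suc n)) → Fin (suc n)
termVal (var i) ρ = ρ i
termVal tmin    ρ = zero
termVal {n = n} tmax ρ = fromℕ n

sat : ∀ {k m n} → (Fin (suc n) → Fin k) → Formula k m → (Fin m → Fin (suc n)) → Bool
sat w (P a t)   ρ = ⌊ w (termVal t ρ) ≟ a ⌋
sat w (s == t)  ρ = ⌊ termVal s ρ ≟ termVal t ρ ⌋
sat w (s <' t)  ρ = ⌊ termVal s ρ <? termVal t ρ ⌋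
sat w (¬' φ)    ρ = not (sat w φ ρ)
sat w (φ ∧' ψ)  ρ = sat w φ ρ ∧ sat w ψ ρ
sat w (φ ∨' ψ)  ρ = sat w φ ρ ∨ sat w ψ ρ
sat {n = n} w (∃' φ) ρ = any (λ i → sat w φ (i VF.∷ ρ)) (allFin (suc n))
sat {n = n} w (∀' φ) ρ = all (λ i → sat w φ (i VF.∷ ρ)) (allFin (suc n))

-- Finite groupoids (arbitrary binary operation on a nonempty finite set,
-- identified with Fin (suc m); its element order is the ordering b_1,…,b_t
-- of the quantifier alphabet, t = suc m).

record Groupoid : Set where
  field
    pred-size : ℕ
    op        : Fin (suc pred-size) → Fin (suc pred-size) → Fin (suc pred-size)

Carrier : Groupoid → Set
Carrier G = Fin (suc (Groupoid.pred-size G))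

data Bracketing (A : Set) : Set where
  leaf : A → Bracketing A
  node : Bracketing A → Bracketing A → Bracketing A

yield : ∀ {A} → Bracketing A → List A
yield (leaf a)   = a ∷ []
yield (node l r) = yield l ++ yield r

value : (G : Groupoid) → Bracketing (Carrier G) → Carrier G
value G (leaf a)   = a
value G (node l r) = Groupoid.op G (value G l) (value G r)

𝒲 : (G : Groupoid) → Subset (suc (Groupoid.pred-size G)) → List (Carrier G) → Set
𝒲 G S u = Σ (Bracketing (Carrier G)) λ b → (yield b ≡ u) × (value G b ∈ S)

-- Unary Lindström quantifier Q_L x[φ_1,…,φ_{t-1}], t = suc m.
-- Letter at position i is b_j for the least j with φ_j(i), else b_t.

firstTrue : ∀ {m} → (Fin m → Bool) → Fin (suc m)
firstTrue {zero}  f = zero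
firstTrue {suc m} f = if f zero then zero else suc (firstTrue (λ j → f (suc j)))

inducedWord : ∀ {k m n} → (Fin (suc n) → Fin k) → (Fin m → Formula k 1)
            → List (Fin (suc m))
inducedWord w φs = tabulate (λ i → firstTrue (λ j → sat w (φs j) (λ _ → i)))

-- language defined by Q_{𝒲(S,G)} x [φs]; only nonempty words are structures
QGrpLang : ∀ {k} (G : Groupoid) → Subset (suc (Groupoid.pred-size G))
         → (Fin (Groupoid.pred-size G) → Formula k 1) → Language k
QGrpLang G S φs []       = ⊥
QGrpLang G S φs (a ∷ as) = 𝒲 G S (inducedWord (Data.List.lookup (a ∷ as)) φs)

QunGrpFO : ∀ {k} → Language k → Set
QunGrpFO {k} L = Σ Groupoid λ G → Σ (Subset (suc (Groupoid.pred-size G))) λ S →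
  Σ (Fin (Groupoid.pred-size G) → Formula k 1) λ φs → L ≐ₗ QGrpLang G S φs

record CFG (k : ℕ) : Set where
  field
    N           : ℕ
    start       : Fin N
    productions : List (Fin N × List (Fin N ⊎ Fin k))

module _ {k : ℕ} (Γ : CFG k) where
  open CFG Γ
  mutual
    data Derives : Fin N → Word k → Set where
      rule : ∀ {A rhs w} → (A , rhs) ∈ₗ productions → DerivesSeq rhs w → Derives A w

    data DerivesSeq : List (Fin N ⊎ Fin k) → Word k → Set where
      []   : DerivesSeq [] []
      term : ∀ {a rest w} → DerivesSeq rest w → DerivesSeq (inj₂ a ∷ rest) (a ∷ w)
      nt   : ∀ {B rest u v} → Derives B u → DerivesSeq rest v
           → DerivesSeq (inj₁ B ∷ rest) (u ++ v)

LangOf : ∀ {k} → CFG k → Language k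
LangOf Γ w = Derives Γ (CFG.start Γ) w

CFL : ∀ {k} → Language k → Set
CFL {k} L = Σ (CFG k) (λ Γ → L ≐ₗ LangOf Γ) × ¬ L []

{-# OPTIONS --safe #-}
-- From groupoids to grammars: an FO formula with one free variable is evaluated at
-- all positions by a bimachine, that is, by a deterministic left-to-right and a
-- deterministic right-to-left scan with finitely many states. A grammar guesses a
-- bracketing together with the states of both scans at the ends of every factor.
--
-- From grammars to groupoids: take sets of suffixes and letters of right-hand sides,
-- with X · Y the set of items deriving a concatenation of an item of X and one of Y,
-- closed under unit productions and erasing of nullable items. The value of a
-- bracketing is then the set of all items deriving its yield along that bracketing,
-- so ambiguity becomes determinism; the formulas only rename letters.

module Submission where

open import Defs
open import Data.Nat using (ℕ; zero; suc; _*_)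
open import Data.Bool using (Bool; true; false; not; _∧_; _∨_; if_then_else_; T)
open import Data.Bool.ListAction using (any; all)
open import Data.Bool.Properties using (T?; T-≡; T-∨; ⇔→≡; ∧-identityʳ; ∧-zeroʳ; ∨-identityʳ)
open import Data.Empty using (⊥-elim)
open import Data.Fin using (Fin; zero; suc; fromℕ; inject₁; combine; remQuot)
open import Data.Fin.Properties using (_≟_; _<?_; any?; remQuot-combine; suc-injective)
open import Data.Fin.Subset using (Subset; _∈_; _⊃_; _∪_; ⁅_⁆) renaming (⊥ to ∅)
open import Data.Fin.Subset.Induction using (⊃-wellFounded; Acc; acc)
open import Data.Fin.Subset.Properties
  using (_∈?_; ∉⊥; p⊆p∪q; q⊆p∪q; x∈p∪q⁻; x∈⁅x⁆; x∈⁅y⁆⇒x≡y)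
open import Data.List
  using (List; []; _∷_; _++_; allFin; concatMap; tabulate; length; lookup; null; foldl; foldr; map; filter)
import Data.List.Membership.DecPropositional as DecMembership
open import Data.List.Membership.Propositional using (lose; find) renaming (_∈_ to _∈ₗ_)
open import Data.List.Membership.Propositional.Properties
  using (∈-map⁺; ∈-map⁻; ∈-++⁺ˡ; ∈-++⁺ʳ; ∈-++⁻; ∈-filter⁺; ∈-filter⁻; ∈-tabulate⁺;
         ∈-lookup; ∈-concatMap⁺; ∈-concatMap⁻)
import Data.List.Properties as List
open import Data.List.Properties
  using (tabulate-cong; tabulate-lookup; map-tabulate; map-++; ++-identityʳ; ++-assoc; ∷-injective;
         foldl-++; foldr-++)
open import Data.List.Relation.Unary.Any using (here; there)
import Data.List.Relation.Unary.Any as Any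
open import Data.List.Relation.Unary.Any.Properties using (lookup-index)
open import Data.Maybe using (Maybe; just; nothing; fromMaybe; _<∣>_)
open import Data.Product using (∃; _×_; _,_; proj₁; proj₂; uncurry)
import Data.Product.Properties as Product
open import Data.Sum using (_⊎_; inj₁; inj₂)
import Data.Sum.Properties as Sum
open import Data.Vec using (Vec; []; _∷_)
import Data.Vec as Vec
import Data.Vec.Functional as VF
open import Data.Vec.Properties using ([]=⇒lookup; lookup⇒[]=; lookup∘tabulate)
open import Function using (_∘_; id)
open import Function.Bundles using (_⇔_; mk⇔; Equivalence)
open import Relation.Nullary using (¬_; Dec; yes; no; does)
open import Relation.Nullary.Decidable
  using (⌊_⌋; _×-dec_; _⊎-dec_; ¬?; toWitness; fromWitness; isYes≗does; dec-true; dec-false;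
         decidable-stable)
open import Relation.Binary.PropositionalEquality
  using (_≡_; _≢_; refl; sym; trans; cong; cong₂; subst; module ≡-Reasoning)

open Equivalence using (to; from)

private variable
  A B C : Set
  k m n : ℕ

-- Booleans, bounded search and decidable subsets

T-ext : ∀ {x y} → (T x → T y) → (T y → T x) → x ≡ y
T-ext f g = ⇔→≡ (mk⇔ (to T-≡ ∘ f ∘ from T-≡) (to T-≡ ∘ g ∘ from T-≡))

any-tabulate⁺ : (p : A → Bool) (f : Fin n → A) (i : Fin n) → T (p (f i)) → T (any p (tabulate f))
any-tabulate⁺ p f zero    h = from T-∨ (inj₁ h)
any-tabulate⁺ p f (suc i) h = from (T-∨ {p (f zero)}) (inj₂ (any-tabulate⁺ p (f ∘ suc) i h))

any-tabulate⁻ : (p : A → Bool) (f : Fin n → A) → T (any p (tabulate f)) → ∃ λ i → T (p (f i))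
any-tabulate⁻ {n = suc n} p f h with to (T-∨ {p (f zero)}) h
... | inj₁ h₀ = zero , h₀
... | inj₂ h₊ with i , hᵢ ← any-tabulate⁻ p (f ∘ suc) h₊ = suc i , hᵢ

all-not-any : (p : A → Bool) (xs : List A) → all p xs ≡ not (any (not ∘ p) xs)
all-not-any p []       = refl
all-not-any p (x ∷ xs) with p x
... | true  = all-not-any p xs
... | false = refl

comprehension : {P : Fin n → Set} → (∀ i → Dec (P i)) → Subset n
comprehension P? = Vec.tabulate (λ i → ⌊ P? i ⌋)

module _ {P : Fin n → Set} (P? : ∀ i → Dec (P i)) where

  ∈-comprehension⁺ : ∀ {i} → P i → i ∈ comprehension P?
  ∈-comprehension⁺ {i} p =
    lookup⇒[]= i _ (trans (lookup∘tabulate _ i) (to T-≡ (fromWitness p)))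

  ∈-comprehension⁻ : ∀ {i} → i ∈ comprehension P? → P i
  ∈-comprehension⁻ {i} p =
    toWitness (from T-≡ (trans (sym (lookup∘tabulate _ i)) ([]=⇒lookup p)))

-- Finite types

-- `A` is a retract of `Fin size`, so `enumerate` may repeat elements. The productions of a grammar
-- only require that the list is exhaustive.
record Finite (A : Set) : Set where
  field
    size       : ℕ
    index      : A → Fin size
    elem       : Fin size → A
    elem-index : ∀ a → elem (index a) ≡ a

  enumerate : List A
  enumerate = tabulate elem

  ∈-enumerate : ∀ a → a ∈ₗ enumerate
  ∈-enumerate a = subst (_∈ₗ enumerate) (elem-index a) (∈-tabulate⁺ (index a))

open Finite

finite-retract : (f : A → B) (g : B → A) → (∀ a → g (f a) ≡ a) → Finite B → Finite A
finite-retract f g gf F = record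
  { size = F .size ; index = F .index ∘ f ; elem = g ∘ F .elem
  ; elem-index = λ a → trans (cong g (F .elem-index (f a))) (gf a) }

finite-Fin : Finite (Fin n)
finite-Fin {n} = record { size = n ; index = id ; elem = id ; elem-index = λ _ → refl }

finite-Maybe : Finite A → Finite (Maybe A)
finite-Maybe {A} F = record { size = suc (F .size) ; index = ix ; elem = el ; elem-index = eq }
  where
  ix : Maybe A → Fin (suc (F .size))
  ix nothing  = zero
  ix (just a) = suc (F .index a)
  el : Fin (suc (F .size)) → Maybe A
  el zero    = nothing
  el (suc i) = just (F .elem i)
  eq : ∀ a → el (ix a) ≡ a
  eq nothing  = refl
  eq (just a) = cong just (F .elem-index a)

finite-× : Finite A → Finite B → Finite (A × B)
finite-× F G = record
  { size = F .size * G .size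
  ; index = λ (a , b) → combine (F .index a) (G .index b)
  ; elem = λ i → let x , y = remQuot (G .size) i in F .elem x , G .elem y
  ; elem-index = λ (a , b) →
      trans (cong (λ (x , y) → F .elem x , G .elem y) (remQuot-combine (F .index a) (G .index b)))
            (cong₂ _,_ (F .elem-index a) (G .elem-index b)) }

finite-Bool : Finite Bool
finite-Bool = finite-retract toFin fromFin fromFin-toFin (finite-Fin {2})
  where
  toFin : Bool → Fin 2
  toFin b = if b then zero else suc zero
  fromFin : Fin 2 → Bool
  fromFin zero    = true
  fromFin (suc _) = false
  fromFin-toFin : ∀ b → fromFin (toFin b) ≡ b
  fromFin-toFin true  = refl
  fromFin-toFin false = refl

opaque
  finite-Subset : ∀ n → Finite (Subset n)
  finite-Subset zero    = finite-retract (λ _ → zero) (λ _ → []) (λ { [] → refl }) (finite-Fin {1})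
  finite-Subset (suc n) =
    finite-retract Vec.uncons (uncurry _∷_) (λ { (_ ∷ _) → refl }) (finite-× finite-Bool (finite-Subset n))

-- Automata on words given as functions on positions

record Automaton (A : Set) : Set₁ where
  field
    State   : Set
    finite  : Finite State
    initial : State
    step    : State → A → State
    accept  : State → Bool

  run : ∀ {n} → State → (Fin n → A) → State
  run {zero}  q g = q
  run {suc n} q g = run (step q (g zero)) (g ∘ suc)

  accepts : (Fin n → A) → Bool
  accepts g = accept (run initial g)

  run-cong : ∀ {n} q {g h : Fin n → A} → (∀ i → g i ≡ h i) → run q g ≡ run q h
  run-cong {zero}  q eq = refl
  run-cong {suc n} q {h = h} eq rewrite eq zero = run-cong (step q (h zero)) (eq ∘ suc)

open Automaton

complement : Automaton A → Automaton A
complement D = record D { accept = not ∘ D .accept }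

run-complement : (D : Automaton A) (q : D .State) (g : Fin n → A) → run (complement D) q g ≡ run D q g
run-complement {n = zero}  D q g = refl
run-complement {n = suc n} D q g = run-complement D (D .step q (g zero)) (g ∘ suc)

accepts-complement : (D : Automaton A) (g : Fin n → A) → accepts (complement D) g ≡ not (accepts D g)
accepts-complement D g = cong (not ∘ D .accept) (run-complement D (D .initial) g)

combineWith : (Bool → Bool → Bool) → Automaton A → Automaton A → Automaton A
combineWith _⊕_ D E = record
  { State   = D .State × E .State
  ; finite  = finite-× (D .finite) (E .finite)
  ; initial = D .initial , E .initial
  ; step    = λ (q , r) a → D .step q a , E .step r a
  ; accept  = λ (q , r) → D .accept q ⊕ E .accept r }

run-combineWith : ∀ _⊕_ (D E : Automaton A) q r (g : Fin n → A) →
                  run (combineWith _⊕_ D E) (q , r) g ≡ (run D q g , run E r g)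
run-combineWith {n = zero}  _⊕_ D E q r g = refl
run-combineWith {n = suc n} _⊕_ D E q r g = run-combineWith _⊕_ D E _ _ (g ∘ suc)

accepts-combineWith : ∀ _⊕_ (D E : Automaton A) (g : Fin n → A) →
                      accepts (combineWith _⊕_ D E) g ≡ (accepts D g ⊕ accepts E g)
accepts-combineWith _⊕_ D E g =
  cong (accept (combineWith _⊕_ D E)) (run-combineWith _⊕_ D E (D .initial) (E .initial) g)

-- The verdict at the first letter on which `d` is defined is kept, since `_<∣>_` prefers its left
-- argument. A word without a verdict is rejected.
firstDecision : (A → Maybe Bool) → Automaton A
firstDecision d = record
  { State   = Maybe Bool
  ; finite  = finite-Maybe finite-Bool
  ; initial = nothing
  ; step    = λ q a → q <∣> d a
  ; accept  = fromMaybe false }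

module _ (d : A → Maybe Bool) where

  private D = firstDecision d

  run-decided : ∀ b (g : Fin n → A) → run D (just b) g ≡ just b
  run-decided {n = zero}  b g = refl
  run-decided {n = suc n} b g = run-decided b (g ∘ suc)

  accepts-at : (g : Fin n → A) (p : Fin n) (f : Fin n → Bool) →
               (∀ i → d (g i) ≡ (if does (p ≟ i) then just (f i) else nothing)) →
               accepts D g ≡ f p
  accepts-at g zero f eq rewrite eq zero = cong (fromMaybe false) (run-decided (f zero) (g ∘ suc))
  accepts-at g (suc p) f eq rewrite eq zero = accepts-at (g ∘ suc) p (f ∘ suc) (eq ∘ suc)

  -- Whichever of `p` and `q` is met first decides. The test for `q` comes first, so `p` equal to
  -- `q` gives `false` and the order is strict.
  accepts-before : (g : Fin n → A) (p q : Fin n) →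
                   (∀ i → d (g i) ≡ (if does (q ≟ i) then just false
                                     else if does (p ≟ i) then just true else nothing)) →
                   accepts D g ≡ does (p <? q)
  accepts-before g zero    zero    eq rewrite eq zero = cong (fromMaybe false) (run-decided false (g ∘ suc))
  accepts-before g zero    (suc q) eq rewrite eq zero = cong (fromMaybe false) (run-decided true (g ∘ suc))
  accepts-before g (suc p) zero    eq rewrite eq zero = cong (fromMaybe false) (run-decided false (g ∘ suc))
  accepts-before g (suc p) (suc q) eq rewrite eq zero = accepts-before (g ∘ suc) p q (eq ∘ suc)

-- Guesses one position to be marked: the first component of a state is the run
-- before the guess, the second collects the runs after it.
projection : (Bool → A → B) → Automaton B → Automaton A
projection e D = record
  { State   = D .State × Subset (D .finite .size)
  ; finite  = finite-× (D .finite) (finite-Subset _)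
  ; initial = D .initial , ∅
  ; step    = λ (q , X) a → D .step q (e false a) , comprehension (successor? q X a)
  ; accept  = λ (q , X) → ⌊ any? (accepting? X) ⌋ }
  where
  ix = D .finite .index
  el = D .finite .elem
  successor? : ∀ q X a y → Dec (y ≡ ix (D .step q (e true a)) ⊎
                                ∃ λ x → x ∈ X × y ≡ ix (D .step (el x) (e false a)))
  successor? q X a y = (y ≟ _) ⊎-dec any? (λ x → (x ∈? X) ×-dec (y ≟ _))
  accepting? : ∀ X x → Dec (x ∈ X × T (D .accept (el x)))
  accepting? X x = (x ∈? X) ×-dec T? _

module _ (e : Bool → A → B) (D : Automaton B) where

  private
    D′ = projection e D
    el = D .finite .elem
    el-ix = D .finite .elem-index

  acceptsMarked : D .State → (Fin n → A) → Fin n → Bool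
  acceptsMarked q g i = D .accept (run D q (λ j → e (does (i ≟ j)) (g j)))

  acceptsUnmarked : D .State → (Fin n → A) → Bool
  acceptsUnmarked q g = D .accept (run D q (e false ∘ g))

  -- Invariant of the scan: acceptance means that some run in `X`, whose mark is already placed,
  -- accepts the unmarked rest, or that marking a position still ahead leads `q` to acceptance.
  projection-sound : ∀ {n} q X (g : Fin n → A) → T (D′ .accept (run D′ (q , X) g)) →
    (∃ λ x → x ∈ X × T (acceptsUnmarked (el x) g)) ⊎ (∃ λ i → T (acceptsMarked q g i))
  projection-sound {zero}  q X g h = inj₁ (toWitness h)
  projection-sound {suc n} q X g h with projection-sound _ _ (g ∘ suc) h
  ... | inj₂ (i , t) = inj₂ (suc i , t)
  ... | inj₁ (y , y∈ , t) with ∈-comprehension⁻ _ y∈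
  -- This state entered the set by marking the current letter, so the marked position is `zero`.
  ...   | inj₁ refl = inj₂ (zero , subst (λ s → T (acceptsUnmarked s (g ∘ suc))) (el-ix _) t)
  ...   | inj₂ (x , x∈ , refl) =
    inj₁ (x , x∈ , subst (λ s → T (acceptsUnmarked s (g ∘ suc))) (el-ix _) t)

  projection-complete : ∀ {n} q X (g : Fin n → A) →
    (∃ λ x → x ∈ X × T (acceptsUnmarked (el x) g)) ⊎ (∃ λ i → T (acceptsMarked q g i)) →
    T (D′ .accept (run D′ (q , X) g))
  projection-complete {zero}  q X g (inj₁ w) = fromWitness w
  projection-complete {suc n} q X g (inj₁ (x , x∈ , t)) =
    projection-complete _ _ (g ∘ suc)
      (inj₁ (_ , ∈-comprehension⁺ _ (inj₂ (x , x∈ , refl)) ,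
             subst (λ s → T (acceptsUnmarked s (g ∘ suc))) (sym (el-ix _)) t))
  projection-complete {suc n} q X g (inj₂ (zero , t)) =
    projection-complete _ _ (g ∘ suc)
      (inj₁ (_ , ∈-comprehension⁺ _ (inj₁ refl) ,
             subst (λ s → T (acceptsUnmarked s (g ∘ suc))) (sym (el-ix _)) t))
  projection-complete {suc n} q X g (inj₂ (suc i , t)) =
    projection-complete _ _ (g ∘ suc) (inj₂ (i , t))

  -- Initially no mark has been placed: the set is empty, and only the second alternative of the
  -- invariant remains.
  accepts-projection : (g : Fin n → A) →
    accepts D′ g ≡ any (λ i → accepts D (λ j → e (does (i ≟ j)) (g j))) (allFin n)
  accepts-projection g = T-ext
    (λ t → case-sound (projection-sound (D .initial) ∅ g t))
    (λ t → projection-complete (D .initial) ∅ g (inj₂ (any-tabulate⁻ _ id t)))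
    where
    case-sound : (∃ λ x → x ∈ ∅ × T (acceptsUnmarked (el x) g)) ⊎ (∃ λ i → T (acceptsMarked (D .initial) g i)) →
                 T (any (acceptsMarked (D .initial) g) (allFin _))
    case-sound (inj₁ (_ , x∈ , _)) = ⊥-elim (∉⊥ x∈)
    case-sound (inj₂ (i , t))      = any-tabulate⁺ (acceptsMarked (D .initial) g) id i t

-- Formulas as automata on marked words

-- A position of a word together with the terms denoting it

record Letter (k m : ℕ) : Set where
  constructor letter
  field
    symbol     : Fin k
    first last : Bool
    marks      : Vec Bool m

open Letter

marked : Term m → Letter k m → Bool
marked (var v) c = Vec.lookup (c .marks) v
marked tmin    c = c .first
marked tmax    c = c .last

mark : Bool → Letter k m → Letter k (suc m)
mark b (letter a f l bs) = letter a f l (b ∷ bs)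

-- Each test has the shape `does (i ≟ j)` used by `acceptsMarked`. Hence `encode w (i VF.∷ ρ) j`
-- unfolds to `mark (does (i ≟ j)) (encode w ρ j)`, which is what the quantifier cases rely on.
encode : (Fin (suc n) → Fin k) → (Fin m → Fin (suc n)) → Fin (suc n) → Letter k m
encode {n} w ρ j =
  letter (w j) (does (zero ≟ j)) (does (fromℕ n ≟ j)) (Vec.tabulate (λ v → does (ρ v ≟ j)))

marked-encode : (w : Fin (suc n) → Fin k) (ρ : Fin m → Fin (suc n)) (t : Term m) (j : Fin (suc n)) →
                marked t (encode w ρ j) ≡ does (termVal t ρ ≟ j)
marked-encode w ρ (var v) j = lookup∘tabulate _ v
marked-encode w ρ tmin    j = refl
marked-encode w ρ tmax    j = refl

-- Büchi's construction, with one track of marks for each free variable. A term denotes exactly one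
-- position, so the letter marked by `t` can settle an atomic formula. The universal quantifier is
-- treated as the dual of the existential one.
automaton : Formula k m → Automaton (Letter k m)
automaton (P a t)  = firstDecision (λ c → if marked t c then just ⌊ c .symbol ≟ a ⌋ else nothing)
automaton (s == t) = firstDecision (λ c → if marked t c then just (marked s c) else nothing)
automaton (s <' t) = firstDecision (λ c → if marked t c then just false
                                          else if marked s c then just true else nothing)
automaton (¬' φ)   = complement (automaton φ)
automaton (φ ∧' ψ) = combineWith _∧_ (automaton φ) (automaton ψ)
automaton (φ ∨' ψ) = combineWith _∨_ (automaton φ) (automaton ψ)
automaton (∃' φ)   = projection mark (automaton φ)
automaton (∀' φ)   = complement (projection mark (complement (automaton φ)))

any-cong : {p q : A → Bool} → (∀ x → p x ≡ q x) → (xs : List A) → any p xs ≡ any q xs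
any-cong eq []       = refl
any-cong eq (x ∷ xs) = cong₂ _∨_ (eq x) (any-cong eq xs)

sat-automaton : (φ : Formula k m) (w : Fin (suc n) → Fin k) (ρ : Fin m → Fin (suc n)) →
                sat w φ ρ ≡ accepts (automaton φ) (encode w ρ)
sat-automaton (P a t) w ρ =
  sym (accepts-at _ _ (termVal t ρ) (λ i → ⌊ w i ≟ a ⌋)
    λ i → cong (if_then just ⌊ w i ≟ a ⌋ else nothing) (marked-encode w ρ t i))
sat-automaton (s == t) w ρ =
  trans (isYes≗does _) (sym (accepts-at _ _ (termVal t ρ) (λ i → does (termVal s ρ ≟ i))
    λ i → cong₂ (λ x y → if x then just y else nothing) (marked-encode w ρ t i) (marked-encode w ρ s i)))
sat-automaton (s <' t) w ρ =
  trans (isYes≗does _) (sym (accepts-before _ _ (termVal s ρ) (termVal t ρ)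
    λ i → cong₂ (λ x y → if x then just false else if y then just true else nothing)
                (marked-encode w ρ t i) (marked-encode w ρ s i)))
sat-automaton (¬' φ) w ρ =
  trans (cong not (sat-automaton φ w ρ)) (sym (accepts-complement (automaton φ) (encode w ρ)))
sat-automaton (φ ∧' ψ) w ρ =
  trans (cong₂ _∧_ (sat-automaton φ w ρ) (sat-automaton ψ w ρ))
        (sym (accepts-combineWith _∧_ (automaton φ) (automaton ψ) (encode w ρ)))
sat-automaton (φ ∨' ψ) w ρ =
  trans (cong₂ _∨_ (sat-automaton φ w ρ) (sat-automaton ψ w ρ))
        (sym (accepts-combineWith _∨_ (automaton φ) (automaton ψ) (encode w ρ)))
sat-automaton {n = n} (∃' φ) w ρ =
  trans (any-cong (λ i → sat-automaton φ w (i VF.∷ ρ)) (allFin (suc n)))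
        (sym (accepts-projection mark (automaton φ) (encode w ρ)))
sat-automaton {n = n} (∀' φ) w ρ = begin
  all (λ i → sat w φ (i VF.∷ ρ)) (allFin (suc n))
    ≡⟨ all-not-any _ (allFin (suc n)) ⟩
  not (any (λ i → not (sat w φ (i VF.∷ ρ))) (allFin (suc n)))
    ≡⟨ cong not (any-cong (λ i → trans (cong not (sat-automaton φ w (i VF.∷ ρ)))
                                       (sym (accepts-complement D (encode w (i VF.∷ ρ))))) (allFin (suc n))) ⟩
  not (any (λ i → accepts (complement D) (encode w (i VF.∷ ρ))) (allFin (suc n)))
    ≡⟨ cong not (accepts-projection mark (complement D) (encode w ρ)) ⟨
  not (accepts (projection mark (complement D)) (encode w ρ))
    ≡⟨ accepts-complement (projection mark (complement D)) (encode w ρ) ⟨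
  accepts (automaton (∀' φ)) (encode w ρ) ∎
  where
  open ≡-Reasoning
  D = automaton φ

-- Bimachines

record Bimachine (k : ℕ) (B : Set) : Set₁ where
  field
    Left Right  : Set
    finiteLeft  : Finite Left
    finiteRight : Finite Right
    left₀       : Left
    right₀      : Right
    stepˡ       : Left → Fin k → Left
    stepʳ       : Fin k → Right → Right
    out         : Left → Fin k → Right → B

  leftAfter : Left → Word k → Left
  leftAfter = foldl stepˡ

  rightBefore : Right → Word k → Right
  rightBefore = foldr stepʳ

  outAt : Left → (w : Word k) → Right → Fin (length w) → B
  outAt p (a ∷ w) r zero    = out p a (rightBefore r w)
  outAt p (a ∷ w) r (suc i) = outAt (stepˡ p a) w r i

  transduce : Left → Word k → Right → List B
  transduce p []      r = []
  transduce p (a ∷ w) r = out p a (rightBefore r w) ∷ transduce (stepˡ p a) w r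

  transduce-outAt : ∀ p w r → transduce p w r ≡ tabulate (outAt p w r)
  transduce-outAt p []      r = refl
  transduce-outAt p (a ∷ w) r = cong (out p a (rightBefore r w) ∷_) (transduce-outAt (stepˡ p a) w r)

  -- The boundary states carry all that a factor has to know of its surroundings: the right scan of
  -- `v` supplies the context of `u`, the left scan of `u` that of `v`.
  transduce-++ : ∀ p u v r → transduce p (u ++ v) r ≡
                 transduce p u (rightBefore r v) ++ transduce (leftAfter p u) v r
  transduce-++ p []      v r = refl
  transduce-++ p (a ∷ u) v r =
    cong₂ _∷_ (cong (out p a) (foldr-++ stepʳ r u v)) (transduce-++ (stepˡ p a) u v r)

  -- One letter is output for each letter read, so a cut of the output determines a cut of the
  -- input.
  transduce-split : ∀ p w r xs ys → xs ++ ys ≡ transduce p w r → ∃ λ u → ∃ λ v →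
    w ≡ u ++ v × xs ≡ transduce p u (rightBefore r v) × ys ≡ transduce (leftAfter p u) v r
  transduce-split p w       r []       ys eq = [] , w , refl , refl , eq
  transduce-split p (a ∷ w) r (x ∷ xs) ys eq
    with x≡ , xs≡ ← ∷-injective eq
    with u , v , refl , xs≡′ , ys≡ ← transduce-split (stepˡ p a) w r xs ys xs≡ =
    a ∷ u , v , refl , cong₂ _∷_ (trans x≡ (cong (out p a) (foldr-++ stepʳ r u v))) xs≡′ , ys≡

open Bimachine

combineBimachines : (A → B → C) → Bimachine k A → Bimachine k B → Bimachine k C
combineBimachines f M N = record
  { Left        = M .Left × N .Left
  ; Right       = M .Right × N .Right
  ; finiteLeft  = finite-× (M .finiteLeft) (N .finiteLeft)
  ; finiteRight = finite-× (M .finiteRight) (N .finiteRight)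
  ; left₀       = M .left₀ , N .left₀
  ; right₀      = M .right₀ , N .right₀
  ; stepˡ       = λ (p , q) a → M .stepˡ p a , N .stepˡ q a
  ; stepʳ       = λ a (r , s) → M .stepʳ a r , N .stepʳ a s
  ; out         = λ (p , q) a (r , s) → f (M .out p a r) (N .out q a s) }

module _ (f : A → B → C) (M : Bimachine k A) (N : Bimachine k B) where

  private MN = combineBimachines f M N

  rightBefore-combine : ∀ r s w →
    rightBefore MN (r , s) w ≡ (rightBefore M r w , rightBefore N s w)
  rightBefore-combine r s []      = refl
  rightBefore-combine r s (a ∷ w) = cong (MN .stepʳ a) (rightBefore-combine r s w)

  outAt-combine : ∀ p q w r s i →
    outAt MN (p , q) w (r , s) i ≡ f (outAt M p w r i) (outAt N q w s i)
  outAt-combine p q (a ∷ w) r s zero    = cong (MN .out (p , q) a) (rightBefore-combine r s w)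
  outAt-combine p q (a ∷ w) r s (suc i) = outAt-combine _ _ w r s i

constant : B → Bimachine k B
constant b = record
  { Left = Fin 1 ; Right = Fin 1 ; finiteLeft = finite-Fin ; finiteRight = finite-Fin
  ; left₀ = zero ; right₀ = zero
  ; stepˡ = λ _ _ → zero ; stepʳ = λ _ _ → zero ; out = λ _ _ _ → b }

outAt-constant : (b : B) (p : Fin 1) (w : Word k) (r : Fin 1) (i : Fin (length w)) →
                 outAt (constant b) p w r i ≡ b
outAt-constant b p (a ∷ w) r zero    = refl
outAt-constant b p (a ∷ w) r (suc i) = outAt-constant b zero w r i

-- The left state is the state reached by the automaton, the right state the set
-- of states from which it accepts the rest; the Boolean flags say whether the
-- next letter on that side would be the first, respectively last, of the word.
positionBimachine : Automaton (Letter k 1) → Bimachine k Bool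
positionBimachine D = record
  { Left        = Bool × D .State
  ; Right       = Bool × Subset (D .finite .size)
  ; finiteLeft  = finite-× finite-Bool (D .finite)
  ; finiteRight = finite-× finite-Bool (finite-Subset _)
  ; left₀       = true , D .initial
  ; right₀      = true , comprehension (λ x → T? (D .accept (el x)))
  ; stepˡ       = λ (f , q) a → false , D .step q (letter a f false (false ∷ []))
  ; stepʳ       = λ a (l , X) →
      false , comprehension (λ x → ix (D .step (el x) (letter a false l (false ∷ []))) ∈? X)
  ; out         = λ (f , q) a (l , X) → ⌊ ix (D .step q (letter a f l (true ∷ []))) ∈? X ⌋ }
  where
  ix = D .finite .index
  el = D .finite .elem

module _ (D : Automaton (Letter k 1)) where

  private
    M = positionBimachine D
    ix = D .finite .index
    el-ix = D .finite .elem-index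

  isLast : Fin n → Bool
  isLast {suc n} j = does (fromℕ n ≟ j)

  suffixLetter : (w : Word k) → Fin (length w) → Letter k 1
  suffixLetter w j = letter (lookup w j) false (isLast j) (false ∷ [])

  rightBefore-flag : ∀ w → proj₁ (rightBefore M (M .right₀) w) ≡ null w
  rightBefore-flag []      = refl
  rightBefore-flag (_ ∷ _) = refl

  ∈?-comprehension : {P : Fin n → Set} (P? : ∀ i → Dec (P i)) (i : Fin n) →
                     ⌊ i ∈? comprehension P? ⌋ ≡ ⌊ P? i ⌋
  ∈?-comprehension P? i = T-ext (fromWitness ∘ ∈-comprehension⁻ P? ∘ toWitness)
                                (fromWitness ∘ ∈-comprehension⁺ P? ∘ toWitness)

  -- The right state is the preimage, under reading `w` without a mark, of the accepting states. It
  -- is built from the end of `w`, and its flag tells each letter whether it is the last one.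
  rightBefore-accepts : ∀ w q →
    ⌊ ix q ∈? proj₂ (rightBefore M (M .right₀) w) ⌋ ≡ D .accept (run D q (suffixLetter w))
  rightBefore-accepts [] q =
    trans (∈?-comprehension _ (ix q))
          (trans (T-ext toWitness fromWitness) (cong (D .accept) (el-ix q)))
  rightBefore-accepts (a ∷ w) q = begin
    ⌊ ix q ∈? proj₂ (rightBefore M (M .right₀) (a ∷ w)) ⌋
      ≡⟨ ∈?-comprehension _ (ix q) ⟩
    ⌊ ix (D .step (D .finite .elem (ix q)) (letter a false l (false ∷ []))) ∈? X ⌋
      ≡⟨ cong₂ (λ q l → ⌊ ix (D .step q (letter a false l (false ∷ []))) ∈? X ⌋)
               (el-ix q) (rightBefore-flag w) ⟩
    ⌊ ix (D .step q (letter a false (null w) (false ∷ []))) ∈? X ⌋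
      ≡⟨ rightBefore-accepts w _ ⟩
    D .accept (run D (D .step q (letter a false (null w) (false ∷ []))) (suffixLetter w))
      ≡⟨ shift w ⟩
    D .accept (run D q (suffixLetter (a ∷ w))) ∎
    where
    open ≡-Reasoning
    l = proj₁ (rightBefore M (M .right₀) w)
    X = proj₂ (rightBefore M (M .right₀) w)
    -- The flag of the leading letter reduces only once it is known whether further letters follow.
    shift : ∀ w → D .accept (run D (D .step q (letter a false (null w) (false ∷ []))) (suffixLetter w))
                  ≡ D .accept (run D q (suffixLetter (a ∷ w)))
    shift []      = refl
    shift (_ ∷ _) = refl

  -- Covers both situations of the induction over positions: `f` is `true` for the whole word and
  -- `false` for a proper suffix, where no letter is the first.
  contextLetter : Bool → (a : Fin k) (w : Word k) (i j : Fin (suc (length w))) → Letter k 1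
  contextLetter f a w i j =
    letter (lookup (a ∷ w) j) (does (zero ≟ j) ∧ f) (does (fromℕ (length w) ≟ j)) (does (i ≟ j) ∷ [])

  outAt-position : ∀ f q a w i →
    outAt M (f , q) (a ∷ w) (M .right₀) i ≡ D .accept (run D q (contextLetter f a w i))
  outAt-position f q a w zero = begin
    ⌊ ix (D .step q (letter a f (proj₁ R) (true ∷ []))) ∈? proj₂ R ⌋
      ≡⟨ cong (λ l → ⌊ ix (D .step q (letter a f l (true ∷ []))) ∈? proj₂ R ⌋) (rightBefore-flag w) ⟩
    ⌊ ix (D .step q (letter a f (null w) (true ∷ []))) ∈? proj₂ R ⌋
      ≡⟨ rightBefore-accepts w _ ⟩
    D .accept (run D (D .step q (letter a f (null w) (true ∷ []))) (suffixLetter w))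
      ≡⟨ shift w ⟩
    D .accept (run D q (contextLetter f a w zero)) ∎
    where
    open ≡-Reasoning
    R = rightBefore M (M .right₀) w
    shift : ∀ w → D .accept (run D (D .step q (letter a f (null w) (true ∷ []))) (suffixLetter w))
                  ≡ D .accept (run D q (contextLetter f a w zero))
    shift []      = refl
    shift (_ ∷ _) = refl
  outAt-position f q a (b ∷ w) (suc i) =
    trans (outAt-position false _ b w i)
          (cong (D .accept) (run-cong D _ λ j →
            cong (λ x → letter (lookup (b ∷ w) j) x (does (fromℕ (length w) ≟ j)) (does (i ≟ j) ∷ []))
                 (∧-zeroʳ (does (zero ≟ j)))))

  outAt-accepts : ∀ a w i → outAt M (M .left₀) (a ∷ w) (M .right₀) i ≡
                            accepts D (encode (lookup (a ∷ w)) (λ _ → i))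
  outAt-accepts a w i =
    trans (outAt-position true _ a w i)
          (cong (D .accept) (run-cong D _ λ j →
            cong (λ x → letter (lookup (a ∷ w) j) x (does (fromℕ (length w) ≟ j)) (does (i ≟ j) ∷ []))
                 (∧-identityʳ (does (zero ≟ j)))))

-- The induced word as the output of a bimachine

-- All formulas are evaluated in parallel. The combination follows the recursion of `firstTrue`, so
-- an earlier formula takes precedence.
letterBimachine : (Fin m → Formula k 1) → Bimachine k (Fin (suc m))
letterBimachine {zero}  φs = constant zero
letterBimachine {suc m} φs =
  combineBimachines (λ b x → if b then zero else suc x)
    (positionBimachine (automaton (φs zero))) (letterBimachine (φs ∘ suc))

outAt-letterBimachine : (φs : Fin m → Formula k 1) → ∀ a w i → let M = letterBimachine φs in
  outAt M (M .left₀) (a ∷ w) (M .right₀) i ≡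
  firstTrue (λ j → sat (lookup (a ∷ w)) (φs j) (λ _ → i))
outAt-letterBimachine {zero}  φs a w i = outAt-constant zero zero (a ∷ w) zero i
outAt-letterBimachine {suc m} φs a w i =
  trans (outAt-combine (λ b x → if b then zero else suc x) M N (M .left₀) (N .left₀) (a ∷ w) (M .right₀) (N .right₀) i)
        (cong₂ (λ b x → if b then zero else suc x)
          (trans (outAt-accepts D a w i) (sym (sat-automaton (φs zero) (lookup (a ∷ w)) (λ _ → i))))
          (outAt-letterBimachine (φs ∘ suc) a w i))
  where
  D = automaton (φs zero)
  M = positionBimachine D
  N = letterBimachine (φs ∘ suc)

transduce-letterBimachine : (φs : Fin m → Formula k 1) → ∀ a w → let M = letterBimachine φs in
  transduce M (M .left₀) (a ∷ w) (M .right₀) ≡ inducedWord (lookup (a ∷ w)) φs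
transduce-letterBimachine φs a w =
  trans (transduce-outAt (letterBimachine φs) _ (a ∷ w) _) (tabulate-cong (outAt-letterBimachine φs a w))

-- The grammar of a groupoid and a bimachine

yield-nonempty : (b : Bracketing A) → ¬ (yield b ≡ [])
yield-nonempty (leaf a)   ()
yield-nonempty (node l r) eq with yield l in eql
... | [] = yield-nonempty l eql

-- The nonterminal (p , g , q , r , s) generates the words that lead from left
-- state p to q and from right state s to r, and whose output evaluates to g.
module BimachineGrammar (G : Groupoid) (S : Subset (suc (Groupoid.pred-size G)))
                        (M : Bimachine k (Carrier G)) where

  private
    L = M .Left
    R = M .Right
    _·_ = Groupoid.op G

  Nonterminal : Set
  Nonterminal = Maybe (L × Carrier G × L × R × R)

  finiteNonterminal : Finite Nonterminal
  finiteNonterminal = finite-Maybe (finite-× (M .finiteLeft) (finite-× finite-Fin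
    (finite-× (M .finiteLeft) (finite-× (M .finiteRight) (M .finiteRight)))))

  ⌜_⌝ : Nonterminal → Fin (finiteNonterminal .size)
  ⌜_⌝ = finiteNonterminal .index

  Rule : Set
  Rule = Fin (finiteNonterminal .size) × List (Fin (finiteNonterminal .size) ⊎ Fin k)

  startRule : Carrier G × L × R → Rule
  startRule (g , q , r) = ⌜ nothing ⌝ , inj₁ ⌜ just (M .left₀ , g , q , r , M .right₀) ⌝ ∷ []

  -- Both factors agree on the states at the cut. There `q` ends the left scan of the first factor,
  -- while `s` ends the right scan of the second one.
  binaryRule : (Carrier G × Carrier G) × (L × L × L) × (R × R × R) → Rule
  binaryRule ((g , h) , (p , q , t) , (r , s , u)) =
    ⌜ just (p , g · h , t , r , u) ⌝ ,
    inj₁ ⌜ just (p , g , q , r , s) ⌝ ∷ inj₁ ⌜ just (q , h , t , s , u) ⌝ ∷ []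

  leafRule : L × Fin k × R → Rule
  leafRule (p , a , r) = ⌜ just (p , M .out p a r , M .stepˡ p a , M .stepʳ a r , r) ⌝ , inj₂ a ∷ []

  finiteStart : Finite (Carrier G × L × R)
  finiteStart = finite-× finite-Fin (finite-× (M .finiteLeft) (M .finiteRight))

  finiteBinary : Finite ((Carrier G × Carrier G) × (L × L × L) × (R × R × R))
  finiteBinary = finite-× (finite-× finite-Fin finite-Fin) (finite-×
    (finite-× (M .finiteLeft) (finite-× (M .finiteLeft) (M .finiteLeft)))
    (finite-× (M .finiteRight) (finite-× (M .finiteRight) (M .finiteRight))))

  finiteLeaf : Finite (L × Fin k × R)
  finiteLeaf = finite-× (M .finiteLeft) (finite-× finite-Fin (M .finiteRight))

  accepting? : ∀ (x : Carrier G × L × R) → Dec (proj₁ x ∈ S)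
  accepting? (g , _) = g ∈? S

  startRules binaryRules leafRules : List Rule
  startRules  = map startRule (filter accepting? (enumerate finiteStart))
  binaryRules = map binaryRule (enumerate finiteBinary)
  leafRules   = map leafRule (enumerate finiteLeaf)

  grammar : CFG k
  grammar = record
    { N = finiteNonterminal .size ; start = ⌜ nothing ⌝
    ; productions = startRules ++ binaryRules ++ leafRules }

  open CFG grammar using (productions)

  Evaluates : L → Carrier G → L → R → R → Word k → Set
  Evaluates p g q r s w = leftAfter M p w ≡ q × rightBefore M s w ≡ r ×
    ∃ λ b → yield b ≡ transduce M p w s × value G b ≡ g

  Accepted : Word k → Set
  Accepted w = 𝒲 G S (transduce M (M .left₀) w (M .right₀))

  -- The intended language of each nonterminal, with `nothing` as the start symbol. Soundness
  -- amounts to every rule preserving it.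
  Meaning : Nonterminal → Word k → Set
  Meaning nothing                    = Accepted
  Meaning (just (p , g , q , r , s)) = Evaluates p g q r s

  MeaningSeq : List (Fin (finiteNonterminal .size) ⊎ Fin k) → Word k → Set
  MeaningSeq []           w = w ≡ []
  MeaningSeq (inj₂ a ∷ α) w = ∃ λ v → w ≡ a ∷ v × MeaningSeq α v
  MeaningSeq (inj₁ X ∷ α) w = ∃ λ u → ∃ λ v →
    w ≡ u ++ v × Meaning (finiteNonterminal .elem X) u × MeaningSeq α v

  decode : ∀ x w → Meaning (finiteNonterminal .elem ⌜ x ⌝) w → Meaning x w
  decode x w = subst (λ y → Meaning y w) (finiteNonterminal .elem-index x)

  startRule-sound : ∀ {g} q r {w} → g ∈ S →
    Evaluates (M .left₀) g q r (M .right₀) w → Accepted w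
  startRule-sound _ _ g∈S (_ , _ , b , yb , refl) = b , yb , g∈S

  binaryRule-sound : ∀ {p q t g h r s z u v} → Evaluates p g q r s u → Evaluates q h t s z v →
    Evaluates p (g · h) t r z (u ++ v)
  binaryRule-sound {p = p} {z = z} {u = u} {v = v}
    (refl , refl , b , yb , refl) (refl , refl , c , yc , refl) =
    foldl-++ (M .stepˡ) p u v , foldr-++ (M .stepʳ) z u v ,
    node b c , trans (cong₂ _++_ yb yc) (sym (transduce-++ M p u v z)) , refl

  rule-sound : ∀ {X α w} → (X , α) ∈ₗ productions → MeaningSeq α w →
    Meaning (finiteNonterminal .elem X) w
  rule-sound {w = w} X∈ m with ∈-++⁻ startRules X∈
  rule-sound {w = w} X∈ m | inj₁ X∈start
    with (g , q , r) , x∈ , refl ← ∈-map⁻ startRule X∈start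
    with u , _ , refl , mu , refl ← m
    rewrite ++-identityʳ u =
    startRule-sound q r (proj₂ (∈-filter⁻ accepting? {xs = enumerate finiteStart} x∈))
      (decode (just (M .left₀ , g , q , r , M .right₀)) u mu)
  rule-sound {w = w} X∈ m | inj₂ X∈′ with ∈-++⁻ binaryRules X∈′
  rule-sound {w = w} X∈ m | inj₂ X∈′ | inj₁ X∈bin
    with ((g , h) , (p , q , t) , (r , s , z)) , _ , refl ← ∈-map⁻ binaryRule X∈bin
    with u , _ , refl , mu , v , _ , refl , mv , refl ← m
    rewrite ++-identityʳ v =
    subst (λ y → Meaning y (u ++ v))
      (sym (finiteNonterminal .elem-index (just (p , g · h , t , r , z))))
      (binaryRule-sound (decode (just (p , g , q , r , s)) u mu) (decode (just (q , h , t , s , z)) v mv))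
  rule-sound {w = w} X∈ m | inj₂ X∈′ | inj₂ X∈leaf
    with (p , a , r) , _ , refl ← ∈-map⁻ leafRule X∈leaf
    with _ , refl , refl ← m =
    subst (λ y → Meaning y (a ∷ []))
      (sym (finiteNonterminal .elem-index (just (p , M .out p a r , M .stepˡ p a , M .stepʳ a r , r))))
      (refl , refl , leaf _ , refl , refl)

  mutual
    sound : ∀ {X w} → Derives grammar X w → Meaning (finiteNonterminal .elem X) w
    sound (rule X∈ d) = rule-sound X∈ (soundSeq d)

    soundSeq : ∀ {α w} → DerivesSeq grammar α w → MeaningSeq α w
    soundSeq []       = refl
    soundSeq (term d) = _ , refl , soundSeq d
    soundSeq (nt d e) = _ , _ , refl , sound d , soundSeq e

  single : ∀ {X w} → Derives grammar X w → DerivesSeq grammar (inj₁ X ∷ []) w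
  single {w = w} d = subst (DerivesSeq grammar _) (++-identityʳ w) (nt d [])

  -- Induction on the bracketing. `transduce-split` turns the cut at the root into a cut of `w`, and
  -- the guessed states are those that the two scans reach there.
  complete : ∀ b p w s → yield b ≡ transduce M p w s →
    Derives grammar ⌜ just (p , value G b , leftAfter M p w , rightBefore M s w , s) ⌝ w
  complete (leaf g) p (a ∷ []) s refl =
    rule (∈-++⁺ʳ startRules (∈-++⁺ʳ binaryRules
           (∈-map⁺ leafRule (∈-enumerate finiteLeaf (p , a , s))))) (term [])
  complete (node b c) p w s eq
    with u , v , refl , yb , yc ← transduce-split M p w s (yield b) (yield c) eq
    rewrite foldl-++ (M .stepˡ) p u v | foldr-++ (M .stepʳ) s u v =
    rule (∈-++⁺ʳ startRules (∈-++⁺ˡ (∈-map⁺ binaryRule (∈-enumerate finiteBinary _))))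
      (nt (complete b p u (rightBefore M s v) yb) (single (complete c (leftAfter M p u) v s yc)))

  Accepted⇔LangOf : ∀ w → Accepted w ⇔ LangOf grammar w
  Accepted⇔LangOf w = mk⇔
    (λ (b , yb , b∈) → rule (∈-++⁺ˡ (∈-map⁺ startRule
        (∈-filter⁺ accepting? (∈-enumerate finiteStart (value G b , _ , _)) b∈)))
      (single (complete b (M .left₀) w (M .right₀) yb)))
    (λ d → decode nothing w (sound d))

QunGrpFO⇒CFL : {L : Language k} → QunGrpFO L → CFL L
QunGrpFO⇒CFL (G , S , φs , L≐) = (grammar , λ w → mk⇔ (to (bridge w) ∘ to (L≐ w)) (from (L≐ w) ∘ from (bridge w))) , to (L≐ [])
  where
  open BimachineGrammar G S (letterBimachine φs)
  bridge : ∀ w → QGrpLang G S φs w ⇔ LangOf grammar w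
  -- The empty word has no bracketing, so the grammar does not derive it, in accordance with the
  -- value `⊥` of `QGrpLang`.
  bridge []      = mk⇔ (λ ()) λ d → let b , yb , _ = from (Accepted⇔LangOf []) d in yield-nonempty b yb
  bridge (a ∷ w) = subst (λ u → 𝒲 G S u ⇔ LangOf grammar (a ∷ w))
                         (transduce-letterBimachine φs a w) (Accepted⇔LangOf (a ∷ w))

-- Least closed subsets by saturation

-- Leastness is an induction principle for arbitrary predicates `Q`, because it will be applied to
-- derivability in a grammar.
record LeastClosed (Step : Subset n → Fin n → Set) : Set₁ where
  field
    set    : Subset n
    closed : ∀ {i} → Step set i → i ∈ set
    least  : (Q : Fin n → Set) → (∀ X → (∀ {i} → i ∈ X → Q i) → ∀ {i} → Step X i → Q i) →
             ∀ {i} → i ∈ set → Q i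

open LeastClosed

opaque
  -- Elements are added one at a time while a step leads out of the set. This stops because strict
  -- growth of subsets of a finite set is well-founded, and the induction principle is carried
  -- along.
  leastClosed : (Step : Subset n → Fin n → Set) → (∀ X i → Dec (Step X i)) → LeastClosed Step
  leastClosed {n} Step step? = saturate ∅ (⊃-wellFounded ∅) (λ _ _ x∈ → ⊥-elim (∉⊥ x∈))
    where
    saturate : ∀ X → Acc _⊃_ X →
      ((Q : Fin n → Set) → (∀ X → (∀ {i} → i ∈ X → Q i) → ∀ {i} → Step X i → Q i) → ∀ {i} → i ∈ X → Q i) →
      LeastClosed Step
    saturate X (acc rec) below with any? (λ i → step? X i ×-dec ¬? (i ∈? X))
    ... | no done = record
      { set = X
      ; closed = λ {i} s → decidable-stable (i ∈? X) (λ i∉ → done (i , s , i∉))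
      ; least = below }
    ... | yes (i , s , i∉) =
      saturate (X ∪ ⁅ i ⁆) (rec (p⊆p∪q _ , i , q⊆p∪q X _ (x∈⁅x⁆ i) , i∉)) below′
      where
      below′ : (Q : Fin n → Set) → (∀ X → (∀ {i} → i ∈ X → Q i) → ∀ {i} → Step X i → Q i) →
               ∀ {j} → j ∈ X ∪ ⁅ i ⁆ → Q j
      below′ Q sound j∈ with x∈p∪q⁻ X _ j∈
      ... | inj₁ j∈X = below Q sound j∈X
      ... | inj₂ j∈i with refl ← x∈⁅y⁆⇒x≡y i j∈i = sound X (below Q sound) s

-- Formulas that rename letters

falsum : Formula k m
falsum = tmin <' tmin

disjunction : (Fin n → Formula k m) → Formula k m
disjunction {zero}  φ = falsum
disjunction {suc n} φ = φ zero ∨' disjunction (φ ∘ suc)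

module _ (w : Fin (suc n) → Fin k) (ρ : Fin m → Fin (suc n)) where

  sat-disjunction-false : ∀ {l} (φ : Fin l → Formula k m) →
    (∀ a → sat w (φ a) ρ ≡ false) → sat w (disjunction φ) ρ ≡ false
  sat-disjunction-false {zero}  φ eq = refl
  sat-disjunction-false {suc l} φ eq = cong₂ _∨_ (eq zero) (sat-disjunction-false (φ ∘ suc) (eq ∘ suc))

  sat-disjunction-at : ∀ {l} (φ : Fin l → Formula k m) c →
    (∀ a → c ≢ a → sat w (φ a) ρ ≡ false) → sat w (disjunction φ) ρ ≡ sat w (φ c) ρ
  sat-disjunction-at φ zero eq
    rewrite sat-disjunction-false (φ ∘ suc) (λ a → eq (suc a) (λ ())) = ∨-identityʳ _
  sat-disjunction-at φ (suc c) eq rewrite eq zero (λ ()) =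
    sat-disjunction-at (φ ∘ suc) c (λ a c≢a → eq (suc a) (c≢a ∘ suc-injective))

-- There is one formula fewer than there are target letters, hence `inject₁`. Where `h` gives the
-- greatest letter all formulas fail, and the default of `firstTrue` supplies it.
letterFormulas : (Fin k → Fin (suc m)) → Fin m → Formula k 1
letterFormulas h j = disjunction (λ a → if does (h a ≟ inject₁ j) then P a (var zero) else falsum)

sat-letterFormulas : (h : Fin k → Fin (suc m)) (w : Fin (suc n) → Fin k) (i : Fin (suc n)) (j : Fin m) →
  sat w (letterFormulas h j) (λ _ → i) ≡ does (h (w i) ≟ inject₁ j)
sat-letterFormulas h w i j = trans (sat-disjunction-at w _ _ (w i) other) same
  where
  other : ∀ a → w i ≢ a →
    sat w (if does (h a ≟ inject₁ j) then P a (var zero) else falsum) (λ _ → i) ≡ false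
  other a wi≢a with does (h a ≟ inject₁ j)
  ... | true  = trans (isYes≗does _) (dec-false (w i ≟ a) wi≢a)
  ... | false = refl
  same : sat w (if does (h (w i) ≟ inject₁ j) then P (w i) (var zero) else falsum) (λ _ → i) ≡
         does (h (w i) ≟ inject₁ j)
  same with does (h (w i) ≟ inject₁ j)
  ... | true  = trans (isYes≗does _) (dec-true (w i ≟ w i) refl)
  ... | false = refl

firstTrue-≟ : (f : Fin m → Bool) (x : Fin (suc m)) → (∀ j → f j ≡ does (x ≟ inject₁ j)) → firstTrue f ≡ x
firstTrue-≟ {zero}  f zero    eq = refl
firstTrue-≟ {suc m} f zero    eq rewrite eq zero = refl
firstTrue-≟ {suc m} f (suc x) eq rewrite eq zero = cong suc (firstTrue-≟ (f ∘ suc) x (eq ∘ suc))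

inducedWord-letterFormulas : (h : Fin k → Fin (suc m)) (a : Fin k) (w : Word k) →
  inducedWord (lookup (a ∷ w)) (letterFormulas h) ≡ map h (a ∷ w)
inducedWord-letterFormulas h a w = begin
  inducedWord (lookup (a ∷ w)) (letterFormulas h)
    ≡⟨ tabulate-cong (λ i → firstTrue-≟ _ (h (lookup (a ∷ w) i)) (sat-letterFormulas h (lookup (a ∷ w)) i)) ⟩
  tabulate (h ∘ lookup (a ∷ w))
    ≡⟨ map-tabulate (lookup (a ∷ w)) h ⟨
  map h (tabulate (lookup (a ∷ w)))
    ≡⟨ cong (map h) (tabulate-lookup (a ∷ w)) ⟩
  map h (a ∷ w) ∎
  where open ≡-Reasoning

map-split : (f : A → B) (w : List A) (xs ys : List B) → xs ++ ys ≡ map f w →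
  ∃ λ u → ∃ λ v → w ≡ u ++ v × xs ≡ map f u × ys ≡ map f v
map-split f w       []       ys eq = [] , w , refl , refl , eq
map-split f (a ∷ w) (x ∷ xs) ys eq
  with x≡ , xs≡ ← ∷-injective eq
  with u , v , refl , xs≡′ , ys≡ ← map-split f w xs ys xs≡ = a ∷ u , v , refl , cong₂ _∷_ x≡ xs≡′ , ys≡

-- Items of a grammar

-- The suffixes and the single symbols of a string: a finite family that contains the string and is
-- closed under separating head from tail.
pieces : List A → List (List A)
pieces []      = [] ∷ []
pieces (x ∷ α) = (x ∷ α) ∷ (x ∷ []) ∷ pieces α

self∈pieces : (α : List A) → α ∈ₗ pieces α
self∈pieces []      = here refl
self∈pieces (_ ∷ _) = here refl

[]∈pieces : (α : List A) → [] ∈ₗ pieces α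
[]∈pieces []      = here refl
[]∈pieces (_ ∷ α) = there (there ([]∈pieces α))

head-tail∈pieces : ∀ γ {x : A} {α} → (x ∷ α) ∈ₗ pieces γ → (x ∷ []) ∈ₗ pieces γ × α ∈ₗ pieces γ
head-tail∈pieces []      (here ())
head-tail∈pieces (y ∷ γ) (here refl)         = there (here refl) , there (there (self∈pieces γ))
head-tail∈pieces (y ∷ γ) (there (here refl)) = there (here refl) , there (there ([]∈pieces γ))
head-tail∈pieces (y ∷ γ) (there (there x∈))
  with h∈ , t∈ ← head-tail∈pieces γ x∈ = there (there h∈) , there (there t∈)

Symbol : CFG k → Set
Symbol {k} Γ = Fin (CFG.N Γ) ⊎ Fin k

-- Items take the place of a normal form: each right-hand side is one, and repeated splitting of
-- head from tail makes all concatenations binary.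
record Items (Γ : CFG k) : Set where
  open CFG Γ
  field
    count     : ℕ
    str       : Fin count → List (Symbol Γ)
    startItem : ∃ λ i → str i ≡ inj₁ start ∷ []
    bodyItem  : ∀ {X α} → (X , α) ∈ₗ productions → ∃ λ i → str i ≡ α
    splitItem : ∀ i {x α} → str i ≡ x ∷ α → (∃ λ j → str j ≡ x ∷ []) × (∃ λ j → str j ≡ α)

grammarItems : (Γ : CFG k) → Items Γ
grammarItems Γ = record
  { count     = length items
  ; str       = lookup items
  ; startItem = sourceItem (here refl)
  ; bodyItem  = λ X∈ → sourceItem (there (∈-map⁺ proj₂ X∈))
  ; splitItem = split }
  where
  open CFG Γ
  sources items : List (List (Symbol Γ))
  sources = (inj₁ start ∷ []) ∷ map proj₂ productions
  items   = concatMap pieces sources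
  itemOf : ∀ {α} → α ∈ₗ items → ∃ λ i → lookup items i ≡ α
  itemOf α∈ = Any.index α∈ , sym (lookup-index α∈)
  sourceItem : ∀ {α} → α ∈ₗ sources → ∃ λ i → lookup items i ≡ α
  sourceItem {α} α∈ = itemOf (∈-concatMap⁺ pieces (lose α∈ (self∈pieces α)))
  split : ∀ i {x α} → lookup items i ≡ x ∷ α →
          (∃ λ j → lookup items j ≡ x ∷ []) × (∃ λ j → lookup items j ≡ α)
  split i eq
    with γ , γ∈ , x∈ ← find (∈-concatMap⁻ pieces {xs = sources} (subst (_∈ₗ items) eq (∈-lookup i)))
    with h∈ , t∈ ← head-tail∈pieces γ x∈ =
    itemOf (∈-concatMap⁺ pieces (lose γ∈ h∈)) , itemOf (∈-concatMap⁺ pieces (lose γ∈ t∈))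

-- The groupoid of sets of items

module SubsetGroupoid (Γ : CFG k) (items : Items Γ) where

  open CFG Γ
  open Items items

  Item : Set
  Item = Fin count

  Produces : Item → Item → Set
  Produces i j = ∃ λ X → str i ≡ inj₁ X ∷ [] × (X , str j) ∈ₗ productions

  Splits : Item → Item → Item → Set
  Splits i j l = str i ≡ str j ++ str l

  NullStep : Subset count → Item → Set
  NullStep X i = str i ≡ [] ⊎ (∃ λ j → Produces i j × j ∈ X) ⊎
                 (∃ λ j → ∃ λ l → Splits i j l × j ∈ X × l ∈ X)

  -- The steps that keep the generated word: passing from a right-hand side to its nonterminal, and
  -- attaching an item of `N`, later the nullable ones, on either side.
  DerivedStep : Subset count → Subset count → Item → Set
  DerivedStep N X i = (∃ λ j → Produces i j × j ∈ X) ⊎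
                      (∃ λ j → ∃ λ l → Splits i j l × (j ∈ N × l ∈ X ⊎ j ∈ X × l ∈ N))

  IsLetter : Fin k → Item → Set
  IsLetter a i = str i ≡ inj₂ a ∷ []

  IsProduct : Subset count → Subset count → Item → Set
  IsProduct X Y i = ∃ λ j → ∃ λ l → Splits i j l × j ∈ X × l ∈ Y

  opaque
    infix 4 _≟ˢ_
    _≟ˢ_ : (α β : List (Symbol Γ)) → Dec (α ≡ β)
    _≟ˢ_ = List.≡-dec (Sum.≡-dec _≟_ _≟_)

    produces? : ∀ i j → Dec (Produces i j)
    produces? i j = any? λ X → (str i ≟ˢ inj₁ X ∷ []) ×-dec ((X , str j) ∈ₗ? productions)
      where open DecMembership (Product.≡-dec _≟_ _≟ˢ_) using () renaming (_∈?_ to _∈ₗ?_)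

    splits? : ∀ i j l → Dec (Splits i j l)
    splits? i j l = str i ≟ˢ str j ++ str l

    nullStep? : ∀ X i → Dec (NullStep X i)
    nullStep? X i =
      (str i ≟ˢ []) ⊎-dec any? (λ j → produces? i j ×-dec (j ∈? X)) ⊎-dec
      any? (λ j → any? λ l → splits? i j l ×-dec (j ∈? X) ×-dec (l ∈? X))

    derivedStep? : ∀ N X i → Dec (DerivedStep N X i)
    derivedStep? N X i =
      any? (λ j → produces? i j ×-dec (j ∈? X)) ⊎-dec
      any? (λ j → any? λ l → splits? i j l ×-dec
        (((j ∈? N) ×-dec (l ∈? X)) ⊎-dec ((j ∈? X) ×-dec (l ∈? N))))

    isLetter? : ∀ a i → Dec (IsLetter a i)
    isLetter? a i = str i ≟ˢ inj₂ a ∷ []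

    isProduct? : ∀ X Y i → Dec (IsProduct X Y i)
    isProduct? X Y i = any? λ j → any? λ l → splits? i j l ×-dec (j ∈? X) ×-dec (l ∈? Y)

  nullable : LeastClosed NullStep
  nullable = leastClosed NullStep nullStep?

  Null : Subset count
  Null = nullable .set

  module _ (Base : Item → Set) (base? : ∀ i → Dec (Base i)) where

    ClosureStep : Subset count → Item → Set
    ClosureStep X i = Base i ⊎ DerivedStep Null X i

    closure : LeastClosed ClosureStep
    closure = leastClosed ClosureStep λ X i → base? i ⊎-dec derivedStep? Null X i

  letterSet : Fin k → Subset count
  letterSet a = closure (IsLetter a) (isLetter? a) .set

  productSet : Subset count → Subset count → Subset count
  productSet X Y = closure (IsProduct X Y) (isProduct? X Y) .set

  private F = finite-Subset count

  -- The element zero is only there to make the carrier visibly nonempty.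
  ⟦_⟧ : Fin (suc (F .size)) → Subset count
  ⟦ zero ⟧  = ∅
  ⟦ suc x ⟧ = F .elem x

  ⌜_⌝ : Subset count → Fin (suc (F .size))
  ⌜ X ⌝ = suc (F .index X)

  groupoid : Groupoid
  groupoid = record
    { pred-size = F .size
    ; op        = λ x y → ⌜ productSet ⟦ x ⟧ ⟦ y ⟧ ⌝ }

  element : Fin k → Fin (suc (F .size))
  element a = ⌜ letterSet a ⌝

  ∈⟦⌜_⌝⟧⁺ : ∀ X {i} → i ∈ X → i ∈ ⟦ ⌜ X ⌝ ⟧
  ∈⟦⌜ X ⌝⟧⁺ = subst (_ ∈_) (sym (F .elem-index X))

  ∈⟦⌜_⌝⟧⁻ : ∀ X {i} → i ∈ ⟦ ⌜ X ⌝ ⟧ → i ∈ X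
  ∈⟦⌜ X ⌝⟧⁻ = subst (_ ∈_) (F .elem-index X)

  Generates : Item → Word k → Set
  Generates i = DerivesSeq Γ (str i)

  derives-++ : ∀ {α β u v} → DerivesSeq Γ α u → DerivesSeq Γ β v → DerivesSeq Γ (α ++ β) (u ++ v)
  derives-++ []       e = e
  derives-++ (term d) e = term (derives-++ d e)
  derives-++ {v = v} (nt {u = u} {v = u′} c d) e =
    subst (DerivesSeq Γ _) (sym (++-assoc u u′ v)) (nt c (derives-++ d e))

  generates-produces : ∀ {i j w} → Produces i j → Generates j w → Generates i w
  generates-produces {w = w} (X , eq , X∈) d rewrite eq =
    subst (DerivesSeq Γ _) (++-identityʳ w) (nt (rule X∈ d) [])

  generates-splits : ∀ {i j l u v} → Splits i j l → Generates j u → Generates l v → Generates i (u ++ v)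
  generates-splits {i} eq d e rewrite eq = derives-++ d e

  null-sound : ∀ {i} → i ∈ Null → Generates i []
  null-sound = nullable .least (λ i → Generates i []) λ where
    X ih (inj₁ eq)                                 → subst (λ α → DerivesSeq Γ α []) (sym eq) []
    X ih (inj₂ (inj₁ (j , p , j∈)))                → generates-produces p (ih j∈)
    X ih (inj₂ (inj₂ (j , l , s , j∈ , l∈)))       → generates-splits s (ih j∈) (ih l∈)

  -- `least` applies to the predicate of generating the fixed word `w`, since derived steps add only
  -- factors that generate the empty word.
  closure-sound : ∀ {Base} base? {w} → (∀ {i} → Base i → Generates i w) →
    ∀ {i} → i ∈ closure Base base? .set → Generates i w
  closure-sound {Base} base? {w} base = closure Base base? .least (λ i → Generates i w) λ where
    X ih (inj₁ b)                                      → base b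
    X ih (inj₂ (inj₁ (j , p , j∈)))                    → generates-produces p (ih j∈)
    X ih (inj₂ (inj₂ (j , l , s , inj₁ (j∈ , l∈))))    → generates-splits s (null-sound j∈) (ih l∈)
    X ih (inj₂ (inj₂ (j , l , s , inj₂ (j∈ , l∈))))    →
      subst (Generates _) (++-identityʳ w) (generates-splits s (ih j∈) (null-sound l∈))

  sound : ∀ b w → yield b ≡ map element w → ∀ {i} → i ∈ ⟦ value groupoid b ⟧ → Generates i w
  sound (leaf _) (a ∷ []) refl i∈ =
    closure-sound (isLetter? a) (λ eq → subst (λ α → DerivesSeq Γ α (a ∷ [])) (sym eq) (term []))
      (∈⟦⌜ letterSet a ⌝⟧⁻ i∈)
  sound (node b c) w eq i∈ with u , v , refl , yb , yc ← map-split element w (yield b) (yield c) eq =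
    closure-sound (isProduct? ⟦ value groupoid b ⟧ ⟦ value groupoid c ⟧)
      (λ (j , l , s , j∈ , l∈) → generates-splits s (sound b u yb j∈) (sound c v yc l∈))
      (∈⟦⌜ productSet ⟦ value groupoid b ⟧ ⟦ value groupoid c ⟧ ⌝⟧⁻ i∈)

  -- Letter sets and products are closures by construction. The assumption on the yield makes the
  -- leaves letter sets; an arbitrary element of the groupoid need not be closed.
  value-closed : ∀ b w → yield b ≡ map element w →
    ∀ {i} → DerivedStep Null ⟦ value groupoid b ⟧ i → i ∈ ⟦ value groupoid b ⟧
  value-closed (leaf _) (a ∷ []) refl =
    subst Derived⊆ (sym (F .elem-index (letterSet a))) (closure (IsLetter a) (isLetter? a) .closed ∘ inj₂)
    where
    Derived⊆ : Subset count → Set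
    Derived⊆ X = ∀ {i} → DerivedStep Null X i → i ∈ X
  value-closed (node b c) w eq =
    subst Derived⊆ (sym (F .elem-index (productSet X Y))) (closure (IsProduct X Y) (isProduct? X Y) .closed ∘ inj₂)
    where
    X = ⟦ value groupoid b ⟧
    Y = ⟦ value groupoid c ⟧
    Derived⊆ : Subset count → Set
    Derived⊆ X = ∀ {i} → DerivedStep Null X i → i ∈ X

  -- Bracketings have nonempty yields, so the empty word is accounted for separately by `Null`.
  Recognised : Item → Word k → Set
  Recognised i w = (w ≡ [] × i ∈ Null) ⊎
                   (∃ λ b → yield b ≡ map element w × i ∈ ⟦ value groupoid b ⟧)

  recognised-produces : ∀ {i j w} → Produces i j → Recognised j w → Recognised i w
  recognised-produces p (inj₁ (w≡ , j∈)) = inj₁ (w≡ , nullable .closed (inj₂ (inj₁ (_ , p , j∈))))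
  recognised-produces p (inj₂ (b , yb , j∈)) =
    inj₂ (b , yb , value-closed b _ yb (inj₁ (_ , p , j∈)))

  -- Only two bracketed factors call for a new node. If one factor is empty, the bracketing of the
  -- other is kept, and closure under nullable items puts `i` into its value.
  recognised-splits : ∀ {i j l u v} → Splits i j l → Recognised j u → Recognised l v → Recognised i (u ++ v)
  recognised-splits s (inj₁ (refl , j∈)) (inj₁ (refl , l∈)) =
    inj₁ (refl , nullable .closed (inj₂ (inj₂ (_ , _ , s , j∈ , l∈))))
  recognised-splits s (inj₁ (refl , j∈)) (inj₂ (c , yc , l∈)) =
    inj₂ (c , yc , value-closed c _ yc (inj₂ (_ , _ , s , inj₁ (j∈ , l∈))))
  recognised-splits {u = u} s (inj₂ (b , yb , j∈)) (inj₁ (refl , l∈)) rewrite ++-identityʳ u =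
    inj₂ (b , yb , value-closed b _ yb (inj₂ (_ , _ , s , inj₂ (j∈ , l∈))))
  recognised-splits {u = u} {v} s (inj₂ (b , yb , j∈)) (inj₂ (c , yc , l∈)) =
    inj₂ (node b c , trans (cong₂ _++_ yb yc) (sym (map-++ element u v)) ,
          ∈⟦⌜ productSet X Y ⌝⟧⁺ (closure (IsProduct X Y) (isProduct? X Y) .closed (inj₁ (_ , _ , s , j∈ , l∈))))
    where
    X = ⟦ value groupoid b ⟧
    Y = ⟦ value groupoid c ⟧

  recognised-letter : ∀ {a i} → IsLetter a i → Recognised i (a ∷ [])
  recognised-letter {a} eq =
    inj₂ (leaf (element a) , refl , ∈⟦⌜ letterSet a ⌝⟧⁺ (closure (IsLetter a) (isLetter? a) .closed (inj₁ eq)))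

  mutual
    complete : ∀ {X w} → Derives Γ X w → ∀ {i} → str i ≡ inj₁ X ∷ [] → Recognised i w
    complete (rule X∈ d) i≡ with j , refl ← bodyItem X∈ =
      recognised-produces (_ , i≡ , X∈) (completeSeq d j refl)

    -- The string is consumed symbol by symbol, with head and tail again items by `splitItem`. The
    -- resulting bracketing combines the head with the bracketing of the tail.
    completeSeq : ∀ {α w} → DerivesSeq Γ α w → ∀ i → str i ≡ α → Recognised i w
    completeSeq []       i eq = inj₁ (refl , nullable .closed (inj₁ eq))
    completeSeq (term d) i eq with (j , j≡) , (l , l≡) ← splitItem i eq =
      recognised-splits (trans eq (sym (cong₂ _++_ j≡ l≡))) (recognised-letter j≡) (completeSeq d l l≡)
    completeSeq (nt c d) i eq with (j , j≡) , (l , l≡) ← splitItem i eq =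
      recognised-splits (trans eq (sym (cong₂ _++_ j≡ l≡))) (complete c j≡) (completeSeq d l l≡)

  accepting? : ∀ x → Dec (proj₁ startItem ∈ ⟦ x ⟧)
  accepting? x = proj₁ startItem ∈? ⟦ x ⟧

  accepting : Subset (suc (F .size))
  accepting = comprehension accepting?

  LangOf⇒𝒲 : ∀ a w → LangOf Γ (a ∷ w) → 𝒲 groupoid accepting (map element (a ∷ w))
  LangOf⇒𝒲 a w d with complete d (proj₂ startItem)
  ... | inj₂ (b , yb , i∈) = b , yb , ∈-comprehension⁺ accepting? i∈

  single⁻ : ∀ {X w} → DerivesSeq Γ (inj₁ X ∷ []) w → Derives Γ X w
  single⁻ (nt {u = u} d []) = subst (Derives Γ _) (sym (++-identityʳ u)) d

  𝒲⇒LangOf : ∀ w → 𝒲 groupoid accepting (map element w) → LangOf Γ w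
  𝒲⇒LangOf w (b , yb , b∈) =
    single⁻ (subst (λ α → DerivesSeq Γ α w) (proj₂ startItem) (sound b w yb (∈-comprehension⁻ accepting? b∈)))

CFL⇒QunGrpFO : {L : Language k} → CFL L → QunGrpFO L
CFL⇒QunGrpFO {k} {L} ((Γ , L≐) , []∉L) = groupoid , accepting , letterFormulas element , equivalence
  where
  open SubsetGroupoid Γ (grammarItems Γ)
  equivalence : L ≐ₗ QGrpLang groupoid accepting (letterFormulas element)
  -- `QGrpLang` excludes the empty word, and here the absence of the empty word from `L` enters.
  equivalence []      = mk⇔ []∉L ⊥-elim
  equivalence (a ∷ w) =
    subst (λ u → L (a ∷ w) ⇔ 𝒲 groupoid accepting u) (sym (inducedWord-letterFormulas element a w))
          (mk⇔ (LangOf⇒𝒲 a w ∘ to (L≐ (a ∷ w))) (from (L≐ (a ∷ w)) ∘ 𝒲⇒LangOf (a ∷ w)))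

theorem15 : (k : ℕ) (L : Language k) → QunGrpFO L ⇔ CFL L
theorem15 k L = mk⇔ QunGrpFO⇒CFL CFL⇒QunGrpFO
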